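{- Let $e,e'$ be resource expressions with $e\asymp e'$. If $\mathrm{supp}(\mathrm{NF}(e))\cap\mathrm{supp}(\mathrm{NF}(e'))\ne\emptyset$ then $e=e'$.
   Context: Resource terms and monomials: $s,t ::= x\mid\lambda x.s\mid\langle s\rangle\bar t\mid s\oplus\bullet\mid\bullet\oplus s$, $\bar t::=[t_1,\dots,t_n]$ (finite multisets of resource terms), up to $\alpha$-equivalence; a resource expression is a term or a monomial. Finite formal sums of resource terms (resp. monomials) with coefficients in $\mathbb N$, supports $\mathrm{supp}(E)$; constructors extended by multilinearity. For $\bar u=[u_1,\dots,u_n]$, $\partial_xe\cdot\bar u$ is defined by: $\partial_xy\cdot\bar u$ is $y$ if $y\ne x$ and $n=0$, $u_1$ if $y=x$ and $n=1$, $0$ otherwise; it commutes with $\lambda y.$ ($y$ fresh), $-\oplus\bullet$, $\bullet\oplus-$; $\partial_x(\langle s\rangle\bar t)\cdot\bar u=\sum_{(I_1,I_2)}\langle\partial_xs\cdot\bar u_{I_1}\rangle(\partial_x\bar t\cdot\bar u_{I_2})$; $\partial_x[t_1,\dots,t_k]\cdot\bar u=\sum_{(I_1,\dots,I_k)}[\partial_xt_1\cdot\bar u_{I_1},\dots,\partial_xt_k\cdot\bar u_{I_k}]$, sums over tuples of pairwise disjoint possibly empty subsets of $\{1,\dots,n\}$ covering it, $\bar u_I=[u_i\mid i\in I]$. The reduction $\to_\partial$ is generated by $\langle\lambda x.s\rangle\bar t\to_\partial\partial_xs\cdot\bar t$, $\langle s\oplus\bullet\rangle\bar t\to_\partial(\langle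 s\rangle\bar t)\oplus\bullet$, $\langle\bullet\oplus s\rangle\bar t\to_\partial\bullet\oplus\langle s\rangle\bar t$, $\lambda x.(s\oplus\bullet)\to_\partial(\lambda x.s)\oplus\bullet$, $\lambda x.(\bullet\oplus s)\to_\partial\bullet\oplus\lambda x.s$, closed under all contexts and extended to sums by $e+F\to_\partial E'+F$ when $e\to_\partial E'$; it is confluent and strongly normalizing and $\mathrm{NF}(E)$ denotes the normal form. The coherence $\asymp$ on resource expressions: $x\asymp x$; $\lambda x.s\asymp\lambda x.s'$ if $s\asymp s'$; $\langle s\rangle\bar t\asymp\langle s'\rangle\bar t'$ if $s\asymp s'$ and $\bar t\asymp\bar t'$; $[t_1,\dots,t_n]\asymp[t_{n+1},\dots,t_{n+m}]$ if $t_i\asymp t_j$ for all $1\le i,j\le n+m$; $s\oplus\bullet\asymp s'\oplus\bullet$ and $\bullet\oplus s\asymp\bullet\oplus s'$ if $s\asymp s'$; $s\oplus\bullet\asymp\bullet\oplus s'$ for all $s,s'$ (the relation is symmetric). -}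

module Defs where

open import Data.Nat using (ℕ; zero; suc; pred; _+_; _<ᵇ_; _≡ᵇ_)
open import Data.Bool using (if_then_else_)
open import Data.List using (List; []; _∷_; [_]; map; concatMap; _++_)
open import Data.List.Membership.Propositional using (_∈_)
open import Data.Product using (_×_; _,_; proj₁; proj₂; Σ)
open import Relation.Nullary using (¬_)
open import Relation.Binary.Construct.Closure.ReflexiveTransitive using (Star)

-- Resource terms, with de Bruijn indices (this realises α-equivalence).
-- Monomials (finite multisets of terms) are lists; they are identified
-- up to permutation by the equality _≈t_/_≈m_ below.

data Term : Set where
  var  : ℕ → Term
  lam  : Term → Term
  app  : Term → List Term → Term
  inl• : Term → Term
  inr• : Term → Term

Monomial : Set
Monomial = List Term

mutual
  data _≈t_ : Term → Term → Set where
    var  : ∀ n → var n ≈t var n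
    lam  : ∀ {s s'} → s ≈t s' → lam s ≈t lam s'
    app  : ∀ {s s' ts ts'} → s ≈t s' → ts ≈m ts' → app s ts ≈t app s' ts'
    inl• : ∀ {s s'} → s ≈t s' → inl• s ≈t inl• s'
    inr• : ∀ {s s'} → s ≈t s' → inr• s ≈t inr• s'

  data _≈m_ : Monomial → Monomial → Set where
    []    : [] ≈m []
    _∷_   : ∀ {t t' ts ts'} → t ≈t t' → ts ≈m ts' → (t ∷ ts) ≈m (t' ∷ ts')
    swap  : ∀ t u ts → (t ∷ u ∷ ts) ≈m (u ∷ t ∷ ts)
    trans : ∀ {ts us vs} → ts ≈m us → us ≈m vs → ts ≈m vs

mutual
  data _≍t_ : Term → Term → Set where
    var   : ∀ n → var n ≍t var n
    lam   : ∀ {s s'} → s ≍t s' → lam s ≍t lam s'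
    app   : ∀ {s s' ts ts'} → s ≍t s' → ts ≍m ts' → app s ts ≍t app s' ts'
    inl•  : ∀ {s s'} → s ≍t s' → inl• s ≍t inl• s'
    inr•  : ∀ {s s'} → s ≍t s' → inr• s ≍t inr• s'
    inlr  : ∀ s s' → inl• s ≍t inr• s'
    inrl  : ∀ s s' → inr• s ≍t inl• s'

  data _≍m_ : Monomial → Monomial → Set where
    coh : ∀ {ts ts'} →
          (∀ t u → t ∈ (ts ++ ts') → u ∈ (ts ++ ts') → t ≍t u) →
          ts ≍m ts'

mutual
  shiftT : ℕ → ℕ → Term → Term
  shiftT c k (var n) = if n <ᵇ c then var n else var (n + k)
  shiftT c k (lam s) = lam (shiftT (suc c) k s)
  shiftT c k (app s ts) = app (shiftT c k s) (shiftM c k ts)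
  shiftT c k (inl• s) = inl• (shiftT c k s)
  shiftT c k (inr• s) = inr• (shiftT c k s)

  shiftM : ℕ → ℕ → Monomial → Monomial
  shiftM c k [] = []
  shiftM c k (t ∷ ts) = shiftT c k t ∷ shiftM c k ts

-- Finite formal sums with coefficients in ℕ are represented as lists
-- (the multiplicity of an element is its coefficient; [] is 0).
-- Splittings of ū into (ū_{I1}, ū_{I2}) over all pairs of disjoint
-- subsets of positions covering all positions.

splits2 : {A : Set} → List A → List (List A × List A)
splits2 [] = ([] , []) ∷ []
splits2 (u ∷ us) =
  concatMap (λ p → (u ∷ proj₁ p , proj₂ p) ∷ (proj₁ p , u ∷ proj₂ p) ∷ [])
            (splits2 us)

-- Linear substitution ∂_x e · ū, where x is the de Bruijn index d
-- (d = number of binders traversed below the contracted λ). The free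
-- variables above d are decremented (the binder disappears) and the
-- substituted terms are weakened by d.

∂var : ℕ → ℕ → List Term → List Term
∂var d n [] = if n <ᵇ d then [ var n ] else (if n ≡ᵇ d then [] else [ var (pred n) ])
∂var d n (u ∷ []) = if n ≡ᵇ d then [ shiftT 0 d u ] else []
∂var d n (_ ∷ _ ∷ _) = []

mutual
  ∂t : ℕ → Term → List Term → List Term
  ∂t d (var n) us = ∂var d n us
  ∂t d (lam s) us = map lam (∂t (suc d) s us)
  ∂t d (app s ts) us =
    concatMap (λ p → concatMap (λ s' → map (app s') (∂m d ts (proj₂ p)))
                               (∂t d s (proj₁ p)))
              (splits2 us)
  ∂t d (inl• s) us = map inl• (∂t d s us)
  ∂t d (inr• s) us = map inr• (∂t d s us)

  -- ∂[t1,...,tk]·ū = Σ over (I1,...,Ik) of [∂t1·ū_{I1},...,∂tk·ū_{Ik}],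
  -- computed by splitting off the part for t1 and recursing.
  ∂m : ℕ → Monomial → List Term → List Monomial
  ∂m d [] [] = [] ∷ []
  ∂m d [] (_ ∷ _) = []
  ∂m d (t ∷ ts) us =
    concatMap (λ p → concatMap (λ t' → map (t' ∷_) (∂m d ts (proj₂ p)))
                               (∂t d t (proj₁ p)))
              (splits2 us)

mutual
  data _⟶t_ : Term → List Term → Set where
    β     : ∀ s ts → app (lam s) ts ⟶t ∂t 0 s ts
    appL  : ∀ s ts → app (inl• s) ts ⟶t [ inl• (app s ts) ]
    appR  : ∀ s ts → app (inr• s) ts ⟶t [ inr• (app s ts) ]
    lamL  : ∀ s → lam (inl• s) ⟶t [ inl• (lam s) ]
    lamR  : ∀ s → lam (inr• s) ⟶t [ inr• (lam s) ]
    ξlam  : ∀ {s S} → s ⟶t S → lam s ⟶t map lam S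
    ξfun  : ∀ {s S} ts → s ⟶t S → app s ts ⟶t map (λ s' → app s' ts) S
    ξarg  : ∀ s {ts M} → ts ⟶m M → app s ts ⟶t map (app s) M
    ξinl• : ∀ {s S} → s ⟶t S → inl• s ⟶t map inl• S
    ξinr• : ∀ {s S} → s ⟶t S → inr• s ⟶t map inr• S

  data _⟶m_ : Monomial → List Monomial → Set where
    here  : ∀ {t T} ts → t ⟶t T → (t ∷ ts) ⟶m map (_∷ ts) T
    there : ∀ t {ts M} → ts ⟶m M → (t ∷ ts) ⟶m map (t ∷_) M

data Sort : Set where
  tm mn : Sort

Exp : Sort → Set
Exp tm = Term
Exp mn = Monomial

Sum : Sort → Set
Sum σ = List (Exp σ)

_≈_ : ∀ {σ} → Exp σ → Exp σ → Set
_≈_ {tm} = _≈t_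
_≈_ {mn} = _≈m_

_≍_ : ∀ {σ} → Exp σ → Exp σ → Set
_≍_ {tm} = _≍t_
_≍_ {mn} = _≍m_

_⟶_ : ∀ {σ} → Exp σ → Sum σ → Set
_⟶_ {tm} = _⟶t_
_⟶_ {mn} = _⟶m_

data _⇒_ {σ : Sort} : Sum σ → Sum σ → Set where
  here  : ∀ {e E'} F → e ⟶ E' → (e ∷ F) ⇒ (E' ++ F)
  there : ∀ f {F F'} → F ⇒ F' → (f ∷ F) ⇒ (f ∷ F')

_⇒*_ : ∀ {σ} → Sum σ → Sum σ → Set
_⇒*_ = Star _⇒_

Normal : ∀ {σ} → Sum σ → Set
Normal E = ∀ F → ¬ (E ⇒ F)

-- N is the normal form NF(E) of E (unique, by confluence).
IsNF : ∀ {σ} → Sum σ → Sum σ → Set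
IsNF E N = (E ⇒* N) × Normal N

_∈supp_ : ∀ {σ} → Exp σ → Sum σ → Set
a ∈supp E = Σ _ λ b → (b ∈ E) × (a ≈ b)

SuppMeet : ∀ {σ} → Sum σ → Sum σ → Set
SuppMeet {σ} E F = Σ (Exp σ) λ a → (a ∈supp E) × (a ∈supp F)

{-# OPTIONS --safe #-}
-- The support of NF(e) is described by an abstract machine
-- s ∣ π ⇓ n ("n occurs in the normal form of s applied to the stack π") which
-- always contracts the head redex. Because substitution is linear, a reduction
-- step anywhere in s or π is matched by exactly one step after a machine
-- transition, so the machine is closed under expansion and therefore reaches
-- every normal term reached by reduction; neither confluence nor termination
-- is needed. Coherent terms drive the machine through the same transitions,
-- and e, ū are determined up to ≈ by any element of ∂ₓe·ū within a coherence
-- class, so equality of results propagates back to the inputs.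
module Submission where

open import Defs
open import Data.Bool using (true; false; T; if_then_else_)
open import Data.Empty using (⊥-elim)
open import Data.List using (List; []; _∷_; [_]; _++_)
open import Data.List.Membership.Propositional using (_∈_; find)
open import Data.List.Membership.Propositional.Properties
  using (∈-map⁻; ∈-concatMap⁻; ∈-++⁻; ∈-++⁺ˡ; ∈-++⁺ʳ)
open import Data.List.Relation.Binary.Permutation.Propositional
  using (_↭_; refl; prep; swap; trans; ↭-sym)
open import Data.List.Relation.Binary.Permutation.Propositional.Properties
  using (∈-resp-↭)
open import Data.List.Relation.Binary.Pointwise using (Pointwise; []; _∷_)
open import Data.List.Relation.Ternary.Interleaving.Propositional
  using (Interleaving; []; consˡ; consʳ; toPermutation)
open import Data.List.Relation.Unary.All as All using (All; []; _∷_)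
open import Data.List.Relation.Unary.Any as Any using (Any; here; there)
import Data.List.Relation.Unary.Any.Properties as Any
open import Data.Nat
  using (ℕ; zero; suc; _+_; _∸_; _<ᵇ_; _≡ᵇ_; _≤_; _<_; z≤n; s≤s; s≤s⁻¹)
open import Data.Nat.Properties
open import Data.Product using (_×_; _,_; proj₁; proj₂; ∃; ∃₂)
open import Data.Sum using (_⊎_; inj₁; inj₂)
open import Data.Unit using (tt)
open import Relation.Binary.Construct.Closure.ReflexiveTransitive as Star using (Star; _◅_)
open import Relation.Binary.PropositionalEquality
  using (_≡_; refl; sym; cong; cong₂; subst; subst₂)
  renaming (trans to ≡-trans)
open import Relation.Nullary using (¬_)

private
  variable
    A B : Set
    c d k m n : ℕ
    s s' t t' u u' f f' : Term
    ts ts' us us' us₁ us₂ ms ms' : List Term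

-- Interleavings

module _ {A : Set} where

  -- Each element of `xs` sits in one cell of a two by two grid, which may be collected by rows or
  -- by columns.
  interchange : {a b c d ab cd xs : List A} →
    Interleaving a b ab → Interleaving c d cd → Interleaving ab cd xs →
    ∃₂ λ ac bd → Interleaving a c ac × Interleaving b d bd × Interleaving ac bd xs
  interchange [] [] [] = _ , _ , [] , [] , []
  interchange (consˡ p) q (consˡ r) =
    let _ , _ , p' , q' , r' = interchange p q r in _ , _ , consˡ p' , q' , consˡ r'
  interchange (consʳ p) q (consˡ r) =
    let _ , _ , p' , q' , r' = interchange p q r in _ , _ , p' , consˡ q' , consʳ r'
  interchange p (consˡ q) (consʳ r) =
    let _ , _ , p' , q' , r' = interchange p q r in _ , _ , consʳ p' , q' , consˡ r'
  interchange p (consʳ q) (consʳ r) =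
    let _ , _ , p' , q' , r' = interchange p q r in _ , _ , p' , consʳ q' , consʳ r'

  interleaving-[]ˡ : (xs : List A) → Interleaving [] xs xs
  interleaving-[]ˡ []       = []
  interleaving-[]ˡ (_ ∷ xs) = consʳ (interleaving-[]ˡ xs)

  interleaving-[]ʳ : (xs : List A) → Interleaving xs [] xs
  interleaving-[]ʳ []       = []
  interleaving-[]ʳ (_ ∷ xs) = consˡ (interleaving-[]ʳ xs)

  interleaving-[]ˡ⁻ : {xs ys : List A} → Interleaving [] xs ys → xs ≡ ys
  interleaving-[]ˡ⁻ []        = refl
  interleaving-[]ˡ⁻ (consʳ p) = cong (_ ∷_) (interleaving-[]ˡ⁻ p)

  interleaving-[]ʳ⁻ : {xs ys : List A} → Interleaving xs [] ys → xs ≡ ys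
  interleaving-[]ʳ⁻ []        = refl
  interleaving-[]ʳ⁻ (consˡ p) = cong (_ ∷_) (interleaving-[]ʳ⁻ p)

  -- This is `interchange` with one of the four blocks empty; `interleaving-exchange` arises in the
  -- same way.
  interleaving-assocˡ : {a b ab c xs : List A} →
    Interleaving a b ab → Interleaving ab c xs →
    ∃ λ bc → Interleaving b c bc × Interleaving a bc xs
  interleaving-assocˡ {c = c} p r
    with _ , _ , p' , q' , r' ← interchange p (interleaving-[]ˡ c) r
    with refl ← interleaving-[]ʳ⁻ p' = _ , q' , r'

  interleaving-exchange : {a b c bc xs : List A} →
    Interleaving b c bc → Interleaving a bc xs →
    ∃ λ ac → Interleaving a c ac × Interleaving b ac xs
  interleaving-exchange {a = a} q r
    with _ , _ , p' , q' , r' ← interchange (interleaving-[]ˡ a) q r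
    with refl ← interleaving-[]ˡ⁻ p' = _ , q' , r'

  All-interleaving⁻ : {P : A → Set} {as bs xs : List A} →
    Interleaving as bs xs → All P xs → All P as × All P bs
  All-interleaving⁻ []        []       = [] , []
  All-interleaving⁻ (consˡ i) (p ∷ ps) = let q , r = All-interleaving⁻ i ps in p ∷ q , r
  All-interleaving⁻ (consʳ i) (p ∷ ps) = let q , r = All-interleaving⁻ i ps in q , p ∷ r

  splits2-sound : (xs : List A) {p : List A × List A} → p ∈ splits2 xs →
    Interleaving (proj₁ p) (proj₂ p) xs
  splits2-sound []       (here refl) = []
  splits2-sound (x ∷ xs) p∈ with find (∈-concatMap⁻ _ {xs = splits2 xs} p∈)
  ... | _ , q∈ , here refl         = consˡ (splits2-sound xs q∈)
  ... | _ , q∈ , there (here refl) = consʳ (splits2-sound xs q∈)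

Pointwise-resp-↭ : {R : A → B → Set} {xs : List A} {ys zs : List B} →
  Pointwise R xs ys → ys ↭ zs → ∃ λ xs' → xs ↭ xs' × Pointwise R xs' zs
Pointwise-resp-↭ rs           refl         = _ , refl , rs
Pointwise-resp-↭ (r ∷ rs)     (prep _ p)   =
  let _ , p' , rs' = Pointwise-resp-↭ rs p in _ , prep _ p' , r ∷ rs'
Pointwise-resp-↭ (r ∷ q ∷ rs) (swap _ _ p) =
  let _ , p' , rs' = Pointwise-resp-↭ rs p in _ , swap _ _ p' , q ∷ r ∷ rs'
Pointwise-resp-↭ rs (trans p q) =
  let _ , p' , rs'  = Pointwise-resp-↭ rs p
      _ , q' , rs'' = Pointwise-resp-↭ rs' q
  in  _ , trans p' q' , rs''

-- Equality up to permutation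

mutual
  ≈t-refl : ∀ s → s ≈t s
  ≈t-refl (var n)    = var n
  ≈t-refl (lam s)    = lam (≈t-refl s)
  ≈t-refl (app s ts) = app (≈t-refl s) (≈m-refl ts)
  ≈t-refl (inl• s)   = inl• (≈t-refl s)
  ≈t-refl (inr• s)   = inr• (≈t-refl s)

  ≈m-refl : ∀ ts → ts ≈m ts
  ≈m-refl []       = []
  ≈m-refl (t ∷ ts) = ≈t-refl t ∷ ≈m-refl ts

mutual
  ≈t-sym : s ≈t t → t ≈t s
  ≈t-sym (var n)   = var n
  ≈t-sym (lam p)   = lam (≈t-sym p)
  ≈t-sym (app p q) = app (≈t-sym p) (≈m-sym q)
  ≈t-sym (inl• p)  = inl• (≈t-sym p)
  ≈t-sym (inr• p)  = inr• (≈t-sym p)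

  ≈m-sym : ts ≈m us → us ≈m ts
  ≈m-sym []            = []
  ≈m-sym (p ∷ q)       = ≈t-sym p ∷ ≈m-sym q
  ≈m-sym (swap t u ts) = swap u t ts
  ≈m-sym (trans p q)   = trans (≈m-sym q) (≈m-sym p)

≈t-trans : s ≈t t → t ≈t u → s ≈t u
≈t-trans (var n)   (var .n)    = var n
≈t-trans (lam p)   (lam q)     = lam (≈t-trans p q)
≈t-trans (app p q) (app p' q') = app (≈t-trans p p') (trans q q')
≈t-trans (inl• p)  (inl• q)    = inl• (≈t-trans p q)
≈t-trans (inr• p)  (inr• q)    = inr• (≈t-trans p q)

↭⇒≈m : ts ↭ us → ts ≈m us
↭⇒≈m refl         = ≈m-refl _
↭⇒≈m (prep x p)   = ≈t-refl x ∷ ↭⇒≈m p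
↭⇒≈m (swap x y p) = trans (swap x y _) (≈t-refl y ∷ ≈t-refl x ∷ ↭⇒≈m p)
↭⇒≈m (trans p q)  = trans (↭⇒≈m p) (↭⇒≈m q)

Pointwise-≈t-refl : ∀ ts → Pointwise _≈t_ ts ts
Pointwise-≈t-refl []       = []
Pointwise-≈t-refl (t ∷ ts) = ≈t-refl t ∷ Pointwise-≈t-refl ts

Pointwise-≈t-trans : Pointwise _≈t_ ts us → Pointwise _≈t_ us ms → Pointwise _≈t_ ts ms
Pointwise-≈t-trans []       []       = []
Pointwise-≈t-trans (p ∷ ps) (q ∷ qs) = ≈t-trans p q ∷ Pointwise-≈t-trans ps qs

-- Separates permuting elements from replacing them. For `trans`, the second permutation is pulled
-- back through the first pointwise step.
≈m⇒↭∘≈t : ts ≈m us → ∃ λ ts' → ts ↭ ts' × Pointwise _≈t_ ts' us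
≈m⇒↭∘≈t []            = _ , refl , []
≈m⇒↭∘≈t (p ∷ q)       = let _ , π , r = ≈m⇒↭∘≈t q in _ , prep _ π , p ∷ r
≈m⇒↭∘≈t (swap t u ts) = _ , swap t u refl , Pointwise-≈t-refl _
≈m⇒↭∘≈t (trans p q)   =
  let _ , π  , r  = ≈m⇒↭∘≈t p
      _ , π' , r' = ≈m⇒↭∘≈t q
      _ , ρ  , r″ = Pointwise-resp-↭ r π'
  in  _ , trans π ρ , Pointwise-≈t-trans r″ r'

-- An interleaving is a concatenation up to permutation. This recovers a bag from the two shares
-- into which a substitution split it.
interleaving-≈m : {as as' bs bs' : List Term} →
  Interleaving as bs us → Interleaving as' bs' us' → as ≈m as' → bs ≈m bs' → us ≈m us'
interleaving-≈m i i' p q =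
  trans (↭⇒≈m (toPermutation i)) (trans (trans (++⁺ʳ _ p) (++⁺ˡ _ q)) (↭⇒≈m (↭-sym (toPermutation i'))))
  where
  ++⁺ʳ : ∀ {as as'} bs → as ≈m as' → (as ++ bs) ≈m (as' ++ bs)
  ++⁺ʳ bs []            = ≈m-refl bs
  ++⁺ʳ bs (p ∷ ps)      = p ∷ ++⁺ʳ bs ps
  ++⁺ʳ bs (swap t u ts) = swap t u (ts ++ bs)
  ++⁺ʳ bs (trans p p')  = trans (++⁺ʳ bs p) (++⁺ʳ bs p')

  ++⁺ˡ : ∀ {bs bs'} as → bs ≈m bs' → (as ++ bs) ≈m (as ++ bs')
  ++⁺ˡ []       q = q
  ++⁺ˡ (t ∷ as) q = ≈t-refl t ∷ ++⁺ˡ as q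

-- Shifts

<ᵇ-true : n < c → (n <ᵇ c) ≡ true
<ᵇ-true {n} {c} n<c with n <ᵇ c | <⇒<ᵇ n<c
... | true | _ = refl

<ᵇ-false : c ≤ n → (n <ᵇ c) ≡ false
<ᵇ-false {c} {n} c≤n with n <ᵇ c in eq
... | false = refl
... | true  = ⊥-elim (<⇒≱ (<ᵇ⇒< n c (subst T (sym eq) tt)) c≤n)

shiftT-var-< : ∀ {c n} k → n < c → shiftT c k (var n) ≡ var n
shiftT-var-< k n<c rewrite <ᵇ-true n<c = refl

shiftT-var-≥ : ∀ {c n} k → c ≤ n → shiftT c k (var n) ≡ var (n + k)
shiftT-var-≥ k c≤n rewrite <ᵇ-false c≤n = refl

mutual
  -- The second cutoff lies in the gap opened by the first shift, so both shifts move the same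
  -- variables.
  shiftT-shiftT : ∀ {c c' d} k s → c ≤ c' → c' ≤ c + d →
    shiftT c' k (shiftT c d s) ≡ shiftT c (d + k) s
  shiftT-shiftT {c} {c'} {d} k (var n) c≤c' c'≤c+d with <-≤-connex n c
  ... | inj₁ n<c rewrite shiftT-var-< d n<c | shiftT-var-< (d + k) n<c =
        shiftT-var-< k (<-≤-trans n<c c≤c')
  ... | inj₂ c≤n rewrite shiftT-var-≥ d c≤n | shiftT-var-≥ (d + k) c≤n =
        ≡-trans (shiftT-var-≥ k (≤-trans c'≤c+d (+-monoˡ-≤ d c≤n))) (cong var (+-assoc n d k))
  shiftT-shiftT k (lam s)    p q = cong lam (shiftT-shiftT k s (s≤s p) (s≤s q))
  shiftT-shiftT k (app s ts) p q = cong₂ app (shiftT-shiftT k s p q) (shiftM-shiftM k ts p q)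
  shiftT-shiftT k (inl• s)   p q = cong inl• (shiftT-shiftT k s p q)
  shiftT-shiftT k (inr• s)   p q = cong inr• (shiftT-shiftT k s p q)

  shiftM-shiftM : ∀ {c c' d} k ts → c ≤ c' → c' ≤ c + d →
    shiftM c' k (shiftM c d ts) ≡ shiftM c (d + k) ts
  shiftM-shiftM k []       p q = refl
  shiftM-shiftM k (t ∷ ts) p q = cong₂ _∷_ (shiftT-shiftT k t p q) (shiftM-shiftM k ts p q)

mutual
  -- As `b ≤ c`, the shift by `d` carries the cutoff `c` to `d + c`.
  shiftT-comm : ∀ {b c} d k s → b ≤ c →
    shiftT (d + c) k (shiftT b d s) ≡ shiftT b d (shiftT c k s)
  shiftT-comm {b} {c} d k (var n) b≤c with <-≤-connex n c
  ... | inj₂ c≤n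
        rewrite shiftT-var-≥ k c≤n | shiftT-var-≥ d (≤-trans b≤c c≤n)
              | shiftT-var-≥ {b} {n + k} d (≤-trans b≤c (m≤n⇒m≤n+o k c≤n))
              | +-comm d c =
        ≡-trans (shiftT-var-≥ k (+-monoˡ-≤ d c≤n))
                (cong var (≡-trans (+-assoc n d k)
                  (≡-trans (cong (n +_) (+-comm d k)) (sym (+-assoc n k d)))))
  ... | inj₁ n<c rewrite shiftT-var-< k n<c with <-≤-connex n b
  ...   | inj₁ n<b rewrite shiftT-var-< d n<b =
          shiftT-var-< k (<-≤-trans n<c (m≤n+m c d))
  ...   | inj₂ b≤n rewrite shiftT-var-≥ d b≤n | +-comm d c =
          shiftT-var-< k (+-monoˡ-< d n<c)
  shiftT-comm {b} {c} d k (lam s) b≤c =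
    cong lam (subst (λ e → shiftT e k (shiftT (suc b) d s) ≡ shiftT (suc b) d (shiftT (suc c) k s))
                    (+-suc d c) (shiftT-comm d k s (s≤s b≤c)))
  shiftT-comm d k (app s ts) b≤c = cong₂ app (shiftT-comm d k s b≤c) (shiftM-comm d k ts b≤c)
  shiftT-comm d k (inl• s)   b≤c = cong inl• (shiftT-comm d k s b≤c)
  shiftT-comm d k (inr• s)   b≤c = cong inr• (shiftT-comm d k s b≤c)

  shiftM-comm : ∀ {b c} d k ts → b ≤ c →
    shiftM (d + c) k (shiftM b d ts) ≡ shiftM b d (shiftM c k ts)
  shiftM-comm d k []       b≤c = refl
  shiftM-comm d k (t ∷ ts) b≤c = cong₂ _∷_ (shiftT-comm d k t b≤c) (shiftM-comm d k ts b≤c)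

shiftM-interleaving : {as bs : Monomial} → Interleaving as bs us →
  Interleaving (shiftM c k as) (shiftM c k bs) (shiftM c k us)
shiftM-interleaving []        = []
shiftM-interleaving (consˡ i) = consˡ (shiftM-interleaving i)
shiftM-interleaving (consʳ i) = consʳ (shiftM-interleaving i)

-- Injectivity of shifting, by a left inverse

mutual
  unshiftT : ℕ → ℕ → Term → Term
  unshiftT c k (var n)    = if n <ᵇ c then var n else var (n ∸ k)
  unshiftT c k (lam s)    = lam (unshiftT (suc c) k s)
  unshiftT c k (app s ts) = app (unshiftT c k s) (unshiftM c k ts)
  unshiftT c k (inl• s)   = inl• (unshiftT c k s)
  unshiftT c k (inr• s)   = inr• (unshiftT c k s)

  unshiftM : ℕ → ℕ → Monomial → Monomial
  unshiftM c k []       = []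
  unshiftM c k (t ∷ ts) = unshiftT c k t ∷ unshiftM c k ts

mutual
  unshiftT-shiftT : ∀ c k s → unshiftT c k (shiftT c k s) ≡ s
  unshiftT-shiftT c k (var n) with <-≤-connex n c
  ... | inj₁ n<c rewrite shiftT-var-< k n<c | <ᵇ-true n<c = refl
  ... | inj₂ c≤n rewrite shiftT-var-≥ k c≤n | <ᵇ-false (m≤n⇒m≤n+o k c≤n) =
        cong var (m+n∸n≡m n k)
  unshiftT-shiftT c k (lam s)    = cong lam (unshiftT-shiftT (suc c) k s)
  unshiftT-shiftT c k (app s ts) = cong₂ app (unshiftT-shiftT c k s) (unshiftM-shiftM c k ts)
  unshiftT-shiftT c k (inl• s)   = cong inl• (unshiftT-shiftT c k s)
  unshiftT-shiftT c k (inr• s)   = cong inr• (unshiftT-shiftT c k s)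

  unshiftM-shiftM : ∀ c k ts → unshiftM c k (shiftM c k ts) ≡ ts
  unshiftM-shiftM c k []       = refl
  unshiftM-shiftM c k (t ∷ ts) = cong₂ _∷_ (unshiftT-shiftT c k t) (unshiftM-shiftM c k ts)

mutual
  unshiftT-cong : ∀ c k → s ≈t s' → unshiftT c k s ≈t unshiftT c k s'
  unshiftT-cong c k (var n)   = ≈t-refl _
  unshiftT-cong c k (lam p)   = lam (unshiftT-cong (suc c) k p)
  unshiftT-cong c k (app p q) = app (unshiftT-cong c k p) (unshiftM-cong c k q)
  unshiftT-cong c k (inl• p)  = inl• (unshiftT-cong c k p)
  unshiftT-cong c k (inr• p)  = inr• (unshiftT-cong c k p)

  unshiftM-cong : ∀ c k → ts ≈m ts' → unshiftM c k ts ≈m unshiftM c k ts'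
  unshiftM-cong c k []            = []
  unshiftM-cong c k (p ∷ q)       = unshiftT-cong c k p ∷ unshiftM-cong c k q
  unshiftM-cong c k (swap t u ts) = swap _ _ _
  unshiftM-cong c k (trans p q)   = trans (unshiftM-cong c k p) (unshiftM-cong c k q)

-- Inverting `_≈m_` directly is awkward, since the middle monomial of `trans` is not given as a
-- shift. Applying a left inverse that respects `_≈t_` avoids the inversion.
shiftT-injective : ∀ c k → shiftT c k s ≈t shiftT c k s' → s ≈t s'
shiftT-injective c k p =
  subst₂ _≈t_ (unshiftT-shiftT c k _) (unshiftT-shiftT c k _) (unshiftT-cong c k p)

∈-shiftM⁻ : ∀ ts → t ∈ shiftM c k ts → ∃ λ u → u ∈ ts × t ≡ shiftT c k u
∈-shiftM⁻ (u ∷ ts) (here eq)  = u , here refl , eq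
∈-shiftM⁻ (u ∷ ts) (there t∈) = let v , v∈ , eq = ∈-shiftM⁻ ts t∈ in v , there v∈ , eq

mutual
  shiftT-≍ : ∀ c k → s ≍t s' → shiftT c k s ≍t shiftT c k s'
  shiftT-≍ c k (var n) with n <ᵇ c
  ... | true  = var n
  ... | false = var (n + k)
  shiftT-≍ c k (lam p)     = lam (shiftT-≍ (suc c) k p)
  shiftT-≍ c k (app p q)   = app (shiftT-≍ c k p) (shiftM-≍ c k q)
  shiftT-≍ c k (inl• p)    = inl• (shiftT-≍ c k p)
  shiftT-≍ c k (inr• p)    = inr• (shiftT-≍ c k p)
  shiftT-≍ c k (inlr s s') = inlr _ _
  shiftT-≍ c k (inrl s s') = inrl _ _

  shiftM-≍ : ∀ c k → ts ≍m ts' → shiftM c k ts ≍m shiftM c k ts'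
  shiftM-≍ {ts} {ts'} c k (coh h) = coh coh'
    where
    preimage : t ∈ (shiftM c k ts ++ shiftM c k ts') →
               ∃ λ u → u ∈ (ts ++ ts') × t ≡ shiftT c k u
    preimage t∈ with ∈-++⁻ (shiftM c k ts) t∈
    ... | inj₁ q = let u , u∈ , eq = ∈-shiftM⁻ ts q in u , ∈-++⁺ˡ u∈ , eq
    ... | inj₂ q = let u , u∈ , eq = ∈-shiftM⁻ ts' q in u , ∈-++⁺ʳ ts u∈ , eq

    coh' : ∀ t u → t ∈ (shiftM c k ts ++ shiftM c k ts') →
           u ∈ (shiftM c k ts ++ shiftM c k ts') → t ≍t u
    coh' t u t∈ u∈ with preimage t∈ | preimage u∈
    ... | v , v∈ , refl | w , w∈ , refl = shiftT-≍ c k (h v w v∈ w∈)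

-- Linear substitution and reduction as relations between elements

mutual
  -- Describes the elements of `∂t d s us`, forgetting multiplicities. Equations are premises of
  -- `here` and `above` so that these can be matched at compound indices such as `k + d`.
  data ∂T : ℕ → Term → List Term → Term → Set where
    here  : n ≡ d → ∂T d (var n) [ u ] (shiftT 0 d u)
    below : n < d → ∂T d (var n) [] (var n)
    above : n ≡ suc m → d ≤ m → ∂T d (var n) [] (var m)
    lam   : ∂T (suc d) s us s' → ∂T d (lam s) us (lam s')
    app   : Interleaving us₁ us₂ us → ∂T d s us₁ s' → ∂M d ts us₂ ts' →
            ∂T d (app s ts) us (app s' ts')
    inl•  : ∂T d s us s' → ∂T d (inl• s) us (inl• s')
    inr•  : ∂T d s us s' → ∂T d (inr• s) us (inr• s')

  data ∂M : ℕ → Monomial → List Term → Monomial → Set where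
    []   : ∂M d [] [] []
    cons : Interleaving us₁ us₂ us → ∂T d t us₁ t' → ∂M d ts us₂ ts' →
           ∂M d (t ∷ ts) us (t' ∷ ts')

∂var-sound : ∀ d n us → f ∈ ∂var d n us → ∂T d (var n) us f
∂var-sound d n [] f∈ with n <ᵇ d in lt
∂var-sound d n [] (here refl) | true = below (<ᵇ⇒< n d (subst T (sym lt) tt))
∂var-sound d n [] f∈ | false with n ≡ᵇ d in eq
-- When both tests fail, `d < n`. Hence `n` is a successor, and `pred` never acts on `zero`.
∂var-sound d zero [] (here refl) | false | false =
  ⊥-elim (subst T eq (≡⇒≡ᵇ 0 d (sym (n≤0⇒n≡0 (≮⇒≥ λ p → subst T lt (<⇒<ᵇ p))))))
∂var-sound d (suc n) [] (here refl) | false | false =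
  above refl (s≤s⁻¹ (≤∧≢⇒< (≮⇒≥ λ p → subst T lt (<⇒<ᵇ p))
                           (λ p → subst T eq (≡⇒≡ᵇ (suc n) d (sym p)))))
∂var-sound d n (u ∷ []) f∈ with n ≡ᵇ d in eq
∂var-sound d n (u ∷ []) (here refl) | true = here (≡ᵇ⇒≡ n d (subst T (sym eq) tt))

mutual
  ∂t-sound : ∀ d s us → f ∈ ∂t d s us → ∂T d s us f
  ∂t-sound d (var n) us f∈ = ∂var-sound d n us f∈
  ∂t-sound d (lam s) us f∈ with _ , g∈ , refl ← ∈-map⁻ lam f∈ =
    lam (∂t-sound (suc d) s us g∈)
  ∂t-sound d (app s ts) us f∈
    with p , p∈ , f∈₁ ← find (∈-concatMap⁻ _ {xs = splits2 us} f∈)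
    with a , a∈ , f∈₂ ← find (∈-concatMap⁻ _ {xs = ∂t d s (proj₁ p)} f∈₁)
    with _ , b∈ , refl ← ∈-map⁻ (app a) f∈₂ =
    app (splits2-sound us p∈) (∂t-sound d s _ a∈) (∂m-sound d ts _ b∈)
  ∂t-sound d (inl• s) us f∈ with _ , g∈ , refl ← ∈-map⁻ inl• f∈ = inl• (∂t-sound d s us g∈)
  ∂t-sound d (inr• s) us f∈ with _ , g∈ , refl ← ∈-map⁻ inr• f∈ = inr• (∂t-sound d s us g∈)

  ∂m-sound : ∀ d ts us → ms ∈ ∂m d ts us → ∂M d ts us ms
  ∂m-sound d [] [] (here refl) = []
  ∂m-sound d (t ∷ ts) us f∈
    with p , p∈ , f∈₁ ← find (∈-concatMap⁻ _ {xs = splits2 us} f∈)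
    with a , a∈ , f∈₂ ← find (∈-concatMap⁻ _ {xs = ∂t d t (proj₁ p)} f∈₁)
    with _ , b∈ , refl ← ∈-map⁻ (a ∷_) f∈₂ =
    cons (splits2-sound us p∈) (∂t-sound d t _ a∈) (∂m-sound d ts _ b∈)

-- Generic in `R`: it serves for a step in one term of a monomial and again for a step in one
-- monomial of a stack.
data AtOne {A : Set} (R : A → A → Set) : List A → List A → Set where
  here  : ∀ {x y xs} → R x y → AtOne R (x ∷ xs) (y ∷ xs)
  there : ∀ {x xs ys} → AtOne R xs ys → AtOne R (x ∷ xs) (x ∷ ys)

-- Follows one summand of a one-step reduct. A redex whose reduct is the empty sum offers no step.
data _↝_ : Term → Term → Set where
  β     : ∂T 0 s ts f → app (lam s) ts ↝ f
  appL  : app (inl• s) ts ↝ inl• (app s ts)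
  appR  : app (inr• s) ts ↝ inr• (app s ts)
  lamL  : lam (inl• s) ↝ inl• (lam s)
  lamR  : lam (inr• s) ↝ inr• (lam s)
  ξlam  : s ↝ s' → lam s ↝ lam s'
  ξfun  : s ↝ s' → app s ts ↝ app s' ts
  ξarg  : AtOne _↝_ ts ts' → app s ts ↝ app s ts'
  ξinl• : s ↝ s' → inl• s ↝ inl• s'
  ξinr• : s ↝ s' → inr• s ↝ inr• s'

_↝m_ : Monomial → Monomial → Set
_↝m_ = AtOne _↝_

mutual
  ⟶t-sound : ∀ {E} → s ⟶t E → f ∈ E → s ↝ f
  ⟶t-sound (β s ts)    f∈          = β (∂t-sound 0 s ts f∈)
  ⟶t-sound (appL s ts) (here refl) = appL
  ⟶t-sound (appR s ts) (here refl) = appR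
  ⟶t-sound (lamL s)    (here refl) = lamL
  ⟶t-sound (lamR s)    (here refl) = lamR
  ⟶t-sound (ξlam r)    f∈ with _ , g∈ , refl ← ∈-map⁻ lam f∈ = ξlam (⟶t-sound r g∈)
  ⟶t-sound (ξfun ts r) f∈ with _ , g∈ , refl ← ∈-map⁻ _ f∈ = ξfun (⟶t-sound r g∈)
  ⟶t-sound (ξarg s r)  f∈ with _ , g∈ , refl ← ∈-map⁻ _ f∈ = ξarg (⟶m-sound r g∈)
  ⟶t-sound (ξinl• r)   f∈ with _ , g∈ , refl ← ∈-map⁻ inl• f∈ = ξinl• (⟶t-sound r g∈)
  ⟶t-sound (ξinr• r)   f∈ with _ , g∈ , refl ← ∈-map⁻ inr• f∈ = ξinr• (⟶t-sound r g∈)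

  ⟶m-sound : ∀ {E} → ts ⟶m E → ms ∈ E → ts ↝m ms
  ⟶m-sound (here ts r)  f∈ with _ , g∈ , refl ← ∈-map⁻ _ f∈ = here (⟶t-sound r g∈)
  ⟶m-sound (there t r)  f∈ with _ , g∈ , refl ← ∈-map⁻ (t ∷_) f∈ = there (⟶m-sound r g∈)

-- Commutation of substitution with shifting, substitution and reduction

mutual
  -- The index `k` lies in the gap opened by the shift, so the variable does not occur and
  -- substituting the empty bag only closes one slot of the gap.
  ∂T-shiftT-suc : ∀ {c k m} u → c ≤ k → k ≤ c + m →
    ∂T k (shiftT c (suc m) u) [] (shiftT c m u)
  ∂T-shiftT-suc {c} {k} {m} (var n) c≤k k≤c+m with <-≤-connex n c
  ... | inj₁ n<c rewrite shiftT-var-< (suc m) n<c | shiftT-var-< m n<c =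
        below (<-≤-trans n<c c≤k)
  ... | inj₂ c≤n rewrite shiftT-var-≥ (suc m) c≤n | shiftT-var-≥ m c≤n =
        above (+-suc n m) (≤-trans k≤c+m (+-monoˡ-≤ m c≤n))
  ∂T-shiftT-suc (lam s)    p q = lam (∂T-shiftT-suc s (s≤s p) (s≤s q))
  ∂T-shiftT-suc (app s ts) p q = app [] (∂T-shiftT-suc s p q) (∂M-shiftM-suc ts p q)
  ∂T-shiftT-suc (inl• s)   p q = inl• (∂T-shiftT-suc s p q)
  ∂T-shiftT-suc (inr• s)   p q = inr• (∂T-shiftT-suc s p q)

  ∂M-shiftM-suc : ∀ {c k m} us → c ≤ k → k ≤ c + m →
    ∂M k (shiftM c (suc m) us) [] (shiftM c m us)
  ∂M-shiftM-suc []       p q = []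
  ∂M-shiftM-suc (u ∷ us) p q = cons [] (∂T-shiftT-suc u p q) (∂M-shiftM-suc us p q)

mutual
  ∂T-shiftT⁻ : ∀ {c d k} b → c ≤ d → ∂T (d + k) (shiftT c k b) us f →
    ∃ λ b' → ∂T d b us b' × f ≡ shiftT c k b'
  ∂T-shiftT⁻ {c = c} {d} {k} (var n) c≤d δ with <-≤-connex n c
  ... | inj₁ n<c rewrite shiftT-var-< k n<c = bound δ
    where
    n<d = <-≤-trans n<c c≤d
    bound : ∂T (d + k) (var n) us f → ∃ λ b' → ∂T d (var n) us b' × f ≡ shiftT c k b'
    bound (here eq) = ⊥-elim (<⇒≱ n<d (≤-trans (m≤m+n d k) (≤-reflexive (sym eq))))
    bound (below _) = var n , below n<d , sym (shiftT-var-< k n<c)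
    bound (above refl p) = ⊥-elim (<⇒≱ n<d (≤-trans (m≤m+n d k) (m≤n⇒m≤1+n p)))
  ... | inj₂ c≤n rewrite shiftT-var-≥ k c≤n = free n c≤n δ refl
    where
    -- The index `x` is kept apart from `n + k`, which could not be unified with the successor in
    -- `above`.
    free : ∀ n {x} → c ≤ n → ∂T (d + k) (var x) us f → x ≡ n + k →
           ∃ λ b' → ∂T d (var n) us b' × f ≡ shiftT c k b'
    free n c≤n (here {u = u} refl) eq =
      shiftT 0 d u , here (+-cancelʳ-≡ k n d (sym eq)) , sym (shiftT-shiftT k u z≤n c≤d)
    free n c≤n (below p) refl = var n , below (+-cancelʳ-< k n d p) , sym (shiftT-var-≥ k c≤n)
    -- Cancelling `k` gives `suc d ≤ n`, so `n` has a predecessor, which is the decremented variable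
    -- before shifting.
    free n c≤n (above refl p) eq with +-cancelʳ-≤ k (suc d) n (≤-trans (s≤s p) (≤-reflexive eq))
    ... | s≤s {n = n'} d≤n' =
      var n' , above refl d≤n'
             , ≡-trans (cong var (suc-injective eq)) (sym (shiftT-var-≥ k (≤-trans c≤d d≤n')))
  ∂T-shiftT⁻ (lam s) p (lam δ) =
    let _ , δ' , eq = ∂T-shiftT⁻ s (s≤s p) δ in _ , lam δ' , cong lam eq
  ∂T-shiftT⁻ (app s ts) p (app i δ ε) =
    let _ , δ' , eq  = ∂T-shiftT⁻ s p δ
        _ , ε' , eq' = ∂M-shiftM⁻ ts p ε
    in  _ , app i δ' ε' , cong₂ app eq eq'
  ∂T-shiftT⁻ (inl• s) p (inl• δ) =
    let _ , δ' , eq = ∂T-shiftT⁻ s p δ in _ , inl• δ' , cong inl• eq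
  ∂T-shiftT⁻ (inr• s) p (inr• δ) =
    let _ , δ' , eq = ∂T-shiftT⁻ s p δ in _ , inr• δ' , cong inr• eq

  ∂M-shiftM⁻ : ∀ {c d k} bs → c ≤ d → ∂M (d + k) (shiftM c k bs) us ms →
    ∃ λ bs' → ∂M d bs us bs' × ms ≡ shiftM c k bs'
  ∂M-shiftM⁻ []       p []           = _ , [] , refl
  ∂M-shiftM⁻ (b ∷ bs) p (cons i δ ε) =
    let _ , δ' , eq  = ∂T-shiftT⁻ b p δ
        _ , ε' , eq' = ∂M-shiftM⁻ bs p ε
    in  _ , cons i δ' ε' , cong₂ _∷_ eq eq'

mutual
  -- Before the substitution the cutoff is one higher, because it also counts the variable `d` that
  -- disappears.
  shiftT-∂T : ∀ {d} c k → ∂T d s us f →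
    ∂T d (shiftT (suc (d + c)) k s) (shiftM c k us) (shiftT (d + c) k f)
  shiftT-∂T {d = d} c k (here {u = u} refl)
    rewrite shiftT-comm {0} {c} d k u z≤n | shiftT-var-< k (s≤s (m≤m+n d c)) = here refl
  shiftT-∂T {d = d} c k (below {n = n} n<d)
    rewrite shiftT-var-< k (<-≤-trans n<d (m≤m+n d c))
          | shiftT-var-< k (<-≤-trans n<d (m≤n⇒m≤1+n (m≤m+n d c))) = below n<d
  shiftT-∂T {d = d} c k (above {m = m} refl d≤m) with <-≤-connex m (d + c)
  ... | inj₁ m<d+c rewrite shiftT-var-< k m<d+c | shiftT-var-< k (s≤s m<d+c) =
        above refl d≤m
  ... | inj₂ d+c≤m rewrite shiftT-var-≥ k d+c≤m | shiftT-var-≥ k (s≤s d+c≤m) =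
        above refl (m≤n⇒m≤n+o k d≤m)
  shiftT-∂T c k (lam δ)     = lam (shiftT-∂T c k δ)
  shiftT-∂T c k (app i δ ε) = app (shiftM-interleaving i) (shiftT-∂T c k δ) (shiftM-∂M c k ε)
  shiftT-∂T c k (inl• δ)    = inl• (shiftT-∂T c k δ)
  shiftT-∂T c k (inr• δ)    = inr• (shiftT-∂T c k δ)

  shiftM-∂M : ∀ {d} c k → ∂M d ts us ms →
    ∂M d (shiftM (suc (d + c)) k ts) (shiftM c k us) (shiftM (d + c) k ms)
  shiftM-∂M c k []           = []
  shiftM-∂M c k (cons i δ ε) = cons (shiftM-interleaving i) (shiftT-∂T c k δ) (shiftM-∂M c k ε)

mutual
  shiftT-↝ : ∀ c k → s ↝ s' → shiftT c k s ↝ shiftT c k s'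
  shiftT-↝ c k (β δ)     = β (shiftT-∂T c k δ)
  shiftT-↝ c k appL      = appL
  shiftT-↝ c k appR      = appR
  shiftT-↝ c k lamL      = lamL
  shiftT-↝ c k lamR      = lamR
  shiftT-↝ c k (ξlam r)  = ξlam (shiftT-↝ (suc c) k r)
  shiftT-↝ c k (ξfun r)  = ξfun (shiftT-↝ c k r)
  shiftT-↝ c k (ξarg r)  = ξarg (shiftM-↝ c k r)
  shiftT-↝ c k (ξinl• r) = ξinl• (shiftT-↝ c k r)
  shiftT-↝ c k (ξinr• r) = ξinr• (shiftT-↝ c k r)

  shiftM-↝ : ∀ c k → ts ↝m ts' → shiftM c k ts ↝m shiftM c k ts'
  shiftM-↝ c k (here r)  = here (shiftT-↝ c k r)
  shiftM-↝ c k (there r) = there (shiftM-↝ c k r)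

-- Lets the inner bag of an iterated substitution be put together again after its two shares were
-- substituted into separately.
∂M-interleaving : ∀ {bs₁ bs₂ bs ms₁ ms₂} →
  Interleaving bs₁ bs₂ bs → ∂M d bs₁ us₁ ms₁ → ∂M d bs₂ us₂ ms₂ → Interleaving us₁ us₂ us →
  ∃ λ ms → Interleaving ms₁ ms₂ ms × ∂M d bs us ms
∂M-interleaving []        []           []           []  = _ , [] , []
∂M-interleaving (consˡ i) (cons j δ ε) ζ            r   =
  let _ , p , q  = interleaving-assocˡ j r
      _ , i' , η = ∂M-interleaving i ε ζ p
  in  _ , consˡ i' , cons q δ η
∂M-interleaving (consʳ i) ε            (cons j δ ζ) r   =
  let _ , p , q  = interleaving-exchange j r
      _ , i' , η = ∂M-interleaving i ε ζ p
  in  _ , consʳ i' , cons q δ η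

-- The instance of ∂ᵧ(∂ₓa·b̄)·ū = Σ ∂ₓ(∂ᵧa·ū₁)·(∂ᵧb̄·ū₂) at a single summand.
mutual
  ∂T-∂T : ∀ {k d a bs} → ∂T k a bs s → ∂T (k + d) s us f →
    ∃₂ λ us₁ us₂ → ∃₂ λ a' bs' → Interleaving us₁ us₂ us ×
      ∂T (suc (k + d)) a us₁ a' × ∂M d bs us₂ bs' × ∂T k a' bs' f
  -- The inserted `b` carries a shift by `k`; below that shift the outer variable has index `d`, and
  -- all of `us` goes to `b`.
  ∂T-∂T {us = us} {f = f} {k = k} {d} (here {u = b} refl) δ
    with _ , δ' , refl ← ∂T-shiftT⁻ b z≤n (subst (λ m → ∂T m (shiftT 0 k b) us f) (+-comm k d) δ) =
    _ , _ , _ , _ , interleaving-[]ˡ _ , below (s≤s (m≤m+n k d)) ,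
    cons (interleaving-[]ʳ _) δ' [] , here refl
  ∂T-∂T {k = k} {d} (below n<k) (here refl) = ⊥-elim (<⇒≱ n<k (m≤m+n k d))
  ∂T-∂T (below n<k) (below n<k+d) =
    _ , _ , _ , _ , [] , below (m≤n⇒m≤1+n n<k+d) , [] , below n<k
  ∂T-∂T {k = k} {d} (below n<k) (above refl p) =
    ⊥-elim (<⇒≱ n<k (≤-trans (m≤m+n k d) (m≤n⇒m≤1+n p)))
  -- Performed first, the outer substitution inserts `u` shifted once more than in the result.
  -- Substituting the empty bag at `k` removes the excess.
  ∂T-∂T {k = k} {d} (above refl k≤n) (here {u = u} refl) =
    _ , _ , _ , _ , consˡ [] , here refl , [] , ∂T-shiftT-suc u z≤n (m≤m+n k d)
  ∂T-∂T (above refl k≤n) (below n<k+d) =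
    _ , _ , _ , _ , [] , below (s≤s n<k+d) , [] , above refl k≤n
  ∂T-∂T {k = k} {d} (above refl k≤n) (above refl p) =
    _ , _ , _ , _ , [] , above refl (s≤s p) , [] , above refl (≤-trans (m≤m+n k d) p)
  ∂T-∂T (lam γ) (lam δ) =
    let _ , _ , _ , _ , i , δ' , ε' , γ' = ∂T-∂T γ δ in _ , _ , _ , _ , i , lam δ' , ε' , lam γ'
  ∂T-∂T (app i γ γ') (app j δ δ') =
    let _ , _ , _ , _ , i₁ , δ₁ , ε₁ , γ₁ = ∂T-∂T γ δ
        _ , _ , _ , _ , i₂ , δ₂ , ε₂ , γ₂ = ∂M-∂M γ' δ'
        -- `us` falls into four blocks, by function or argument position and by body or inner bag;
        -- `interchange` regroups them by the latter.
        _ , _ , p , q , r = interchange i₁ i₂ j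
        _ , i' , ε = ∂M-interleaving i ε₁ ε₂ q
    in  _ , _ , _ , _ , r , app p δ₁ δ₂ , ε , app i' γ₁ γ₂
  ∂T-∂T (inl• γ) (inl• δ) =
    let _ , _ , _ , _ , i , δ' , ε' , γ' = ∂T-∂T γ δ in _ , _ , _ , _ , i , inl• δ' , ε' , inl• γ'
  ∂T-∂T (inr• γ) (inr• δ) =
    let _ , _ , _ , _ , i , δ' , ε' , γ' = ∂T-∂T γ δ in _ , _ , _ , _ , i , inr• δ' , ε' , inr• γ'

  ∂M-∂M : ∀ {k d as bs} → ∂M k as bs ts → ∂M (k + d) ts us ms →
    ∃₂ λ us₁ us₂ → ∃₂ λ as' bs' → Interleaving us₁ us₂ us ×
      ∂M (suc (k + d)) as us₁ as' × ∂M d bs us₂ bs' × ∂M k as' bs' ms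
  ∂M-∂M [] [] = _ , _ , _ , _ , [] , [] , [] , []
  ∂M-∂M (cons i γ γ') (cons j δ δ') =
    let _ , _ , _ , _ , i₁ , δ₁ , ε₁ , γ₁ = ∂T-∂T γ δ
        _ , _ , _ , _ , i₂ , δ₂ , ε₂ , γ₂ = ∂M-∂M γ' δ'
        _ , _ , p , q , r = interchange i₁ i₂ j
        _ , i' , ε = ∂M-interleaving i ε₁ ε₂ q
    in  _ , _ , _ , _ , r , cons p δ₁ δ₂ , ε , cons i' γ₁ γ₂

-- Reduction steps pulled back through substitution

mutual
  -- Substitution keeps the redex in place: for β this is `∂T-∂T`, and for the commutations of sums
  -- it is immediate.
  ∂T-expandˡ : s ↝ s' → ∂T d s' us f' → ∃ λ f → ∂T d s us f × f ↝ f'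
  ∂T-expandˡ (β γ) δ =
    let _ , _ , _ , _ , i , δ' , ε' , γ' = ∂T-∂T γ δ in _ , app i (lam δ') ε' , β γ'
  ∂T-expandˡ appL (inl• (app i δ ε)) = _ , app i (inl• δ) ε , appL
  ∂T-expandˡ appR (inr• (app i δ ε)) = _ , app i (inr• δ) ε , appR
  ∂T-expandˡ lamL (inl• (lam δ))     = _ , lam (inl• δ) , lamL
  ∂T-expandˡ lamR (inr• (lam δ))     = _ , lam (inr• δ) , lamR
  ∂T-expandˡ (ξlam r) (lam δ) = let _ , δ' , r' = ∂T-expandˡ r δ in _ , lam δ' , ξlam r'
  ∂T-expandˡ (ξfun r) (app i δ ε) =
    let _ , δ' , r' = ∂T-expandˡ r δ in _ , app i δ' ε , ξfun r'
  ∂T-expandˡ (ξarg r) (app i δ ε) =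
    let _ , ε' , r' = ∂M-expandˡ r ε in _ , app i δ ε' , ξarg r'
  ∂T-expandˡ (ξinl• r) (inl• δ) = let _ , δ' , r' = ∂T-expandˡ r δ in _ , inl• δ' , ξinl• r'
  ∂T-expandˡ (ξinr• r) (inr• δ) = let _ , δ' , r' = ∂T-expandˡ r δ in _ , inr• δ' , ξinr• r'

  ∂M-expandˡ : ts ↝m ts' → ∂M d ts' us ms' → ∃ λ ms → ∂M d ts us ms × ms ↝m ms'
  ∂M-expandˡ (here r) (cons i δ ε) =
    let _ , δ' , r' = ∂T-expandˡ r δ in _ , cons i δ' ε , here r'
  ∂M-expandˡ (there r) (cons i δ ε) =
    let _ , ε' , r' = ∂M-expandˡ r ε in _ , cons i δ ε' , there r'

AtOne-interleaving⁻ : {R : A → A → Set} {xs ys ls rs : List A} →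
  AtOne R xs ys → Interleaving ls rs ys →
  (∃ λ ls' → AtOne R ls' ls × Interleaving ls' rs xs) ⊎
  (∃ λ rs' → AtOne R rs' rs × Interleaving ls rs' xs)
AtOne-interleaving⁻ (here r)  (consˡ i) = inj₁ (_ , here r , consˡ i)
AtOne-interleaving⁻ (here r)  (consʳ i) = inj₂ (_ , here r , consʳ i)
AtOne-interleaving⁻ (there r) (consˡ i) with AtOne-interleaving⁻ r i
... | inj₁ (_ , r' , i') = inj₁ (_ , there r' , consˡ i')
... | inj₂ (_ , r' , i') = inj₂ (_ , r' , consˡ i')
AtOne-interleaving⁻ (there r) (consʳ i) with AtOne-interleaving⁻ r i
... | inj₁ (_ , r' , i') = inj₁ (_ , r' , consʳ i')
... | inj₂ (_ , r' , i') = inj₂ (_ , there r' , consʳ i')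

mutual
  -- Linearity is essential: each element of the bag is inserted exactly once, so a step in the bag
  -- gives one step in the result, neither erased nor duplicated.
  ∂T-expandʳ : us ↝m us' → ∂T d s us' f' → ∃ λ f → ∂T d s us f × f ↝ f'
  ∂T-expandʳ {d = d} (here r) (here refl) = _ , here refl , shiftT-↝ 0 d r
  ∂T-expandʳ r (lam δ) = let _ , δ' , r' = ∂T-expandʳ r δ in _ , lam δ' , ξlam r'
  ∂T-expandʳ r (app i δ ε) with AtOne-interleaving⁻ r i
  ... | inj₁ (_ , q , i') = let _ , δ' , r' = ∂T-expandʳ q δ in _ , app i' δ' ε , ξfun r'
  ... | inj₂ (_ , q , i') = let _ , ε' , r' = ∂M-expandʳ q ε in _ , app i' δ ε' , ξarg r'
  ∂T-expandʳ r (inl• δ) = let _ , δ' , r' = ∂T-expandʳ r δ in _ , inl• δ' , ξinl• r'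
  ∂T-expandʳ r (inr• δ) = let _ , δ' , r' = ∂T-expandʳ r δ in _ , inr• δ' , ξinr• r'

  ∂M-expandʳ : us ↝m us' → ∂M d ts us' ms' → ∃ λ ms → ∂M d ts us ms × ms ↝m ms'
  ∂M-expandʳ r (cons i δ ε) with AtOne-interleaving⁻ r i
  ... | inj₁ (_ , q , i') = let _ , δ' , r' = ∂T-expandʳ q δ in _ , cons i' δ' ε , here r'
  ... | inj₂ (_ , q , i') = let _ , ε' , r' = ∂M-expandʳ q ε in _ , cons i' δ ε' , there r'

-- Coherence and substitution

-- A clique given as a predicate is inherited by all shares of the bags, however the two sides are
-- split.
module _ {P : Term → Set} (clique : ∀ {t u} → P t → P u → t ≍t u) where

  ∈-∂M⁻ : All P us → ∂M d ts us ms → f ∈ ms →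
    ∃₂ λ t us' → t ∈ ts × All P us' × ∂T d t us' f
  ∈-∂M⁻ ps (cons i δ ε) (here refl) =
    _ , _ , here refl , proj₁ (All-interleaving⁻ i ps) , δ
  ∈-∂M⁻ ps (cons i δ ε) (there f∈) =
    let _ , _ , t∈ , ps' , δ' = ∈-∂M⁻ (proj₂ (All-interleaving⁻ i ps)) ε f∈
    in  _ , _ , there t∈ , ps' , δ'

  mutual
    ∂T-≍ : s ≍t s' → All P us → All P us' → ∂T d s us f → ∂T d s' us' f' → f ≍t f'
    ∂T-≍ {d = d} (var n) (p ∷ _) (p' ∷ _) (here _) (here _) = shiftT-≍ 0 d (clique p p')
    ∂T-≍ (var n) ps ps' (here refl)    (below q)      = ⊥-elim (<-irrefl refl q)
    ∂T-≍ (var n) ps ps' (here refl)    (above refl q) = ⊥-elim (<-irrefl refl q)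
    ∂T-≍ (var n) ps ps' (below q)      (here refl)    = ⊥-elim (<-irrefl refl q)
    ∂T-≍ (var n) ps ps' (below q)      (below _)      = var n
    ∂T-≍ (var n) ps ps' (below q)      (above refl r) = ⊥-elim (<⇒≱ q (m≤n⇒m≤1+n r))
    ∂T-≍ (var n) ps ps' (above refl q) (here refl)    = ⊥-elim (<-irrefl refl q)
    ∂T-≍ (var n) ps ps' (above refl q) (below r)      = ⊥-elim (<⇒≱ r (m≤n⇒m≤1+n q))
    ∂T-≍ (var n) ps ps' (above refl _) (above refl _) = var _
    ∂T-≍ (lam p) ps ps' (lam δ) (lam δ') = lam (∂T-≍ p ps ps' δ δ')
    ∂T-≍ (app p q) ps ps' (app i δ ε) (app i' δ' ε') =
      let ps₁  , ps₂  = All-interleaving⁻ i ps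
          ps₁' , ps₂' = All-interleaving⁻ i' ps'
      in  app (∂T-≍ p ps₁ ps₁' δ δ') (∂M-≍ q ps₂ ps₂' ε ε')
    ∂T-≍ (inl• p)    ps ps' (inl• δ) (inl• δ') = inl• (∂T-≍ p ps ps' δ δ')
    ∂T-≍ (inr• p)    ps ps' (inr• δ) (inr• δ') = inr• (∂T-≍ p ps ps' δ δ')
    ∂T-≍ (inlr s s') ps ps' (inl• δ) (inr• δ') = inlr _ _
    ∂T-≍ (inrl s s') ps ps' (inr• δ) (inl• δ') = inrl _ _

    ∂M-≍ : ts ≍m ts' → All P us → All P us' → ∂M d ts us ms → ∂M d ts' us' ms' → ms ≍m ms'
    ∂M-≍ {ts = ts} {ts'} {d = d} {ms} {ms'} (coh h) ps ps' ε ε' = coh coh'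
      where
      preimage : f ∈ (ms ++ ms') → ∃₂ λ t us → t ∈ (ts ++ ts') × All P us × ∂T d t us f
      preimage f∈ with ∈-++⁻ ms f∈
      ... | inj₁ q = let _ , _ , t∈ , a , δ = ∈-∂M⁻ ps ε q in _ , _ , ∈-++⁺ˡ t∈ , a , δ
      ... | inj₂ q = let _ , _ , t∈ , a , δ = ∈-∂M⁻ ps' ε' q in _ , _ , ∈-++⁺ʳ ts t∈ , a , δ

      coh' : ∀ f g → f ∈ (ms ++ ms') → g ∈ (ms ++ ms') → f ≍t g
      coh' f g f∈ g∈ with preimage f∈ | preimage g∈
      -- Both elements may come from the same monomial, with different shares of its bag; they are
      -- still coherent, since all shares lie in `P`.
      ... | t , _ , t∈ , a , δ | u , _ , u∈ , b , δ' = ∂T-≍ (h t u t∈ u∈) a b δ δ'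

-- Injectivity of substitution on coherent expressions

∂M-resp-↭ : ∂M d ts us ms → ms ↭ ms' → ∃ λ ts' → ts ↭ ts' × ∂M d ts' us ms'
∂M-resp-↭ ε refl = _ , refl , ε
∂M-resp-↭ (cons i δ ε) (prep _ p) =
  let _ , p' , ε' = ∂M-resp-↭ ε p in _ , prep _ p' , cons i δ ε'
∂M-resp-↭ (cons i δ (cons j γ ε)) (swap _ _ p) =
  let _ , p' , ε' = ∂M-resp-↭ ε p
      _ , i' , j' = interleaving-exchange j i
  in  _ , swap _ _ p' , cons j' γ (cons i' δ ε')
∂M-resp-↭ ε (trans p q) =
  let _ , p' , ε'  = ∂M-resp-↭ ε p
      _ , q' , ε'' = ∂M-resp-↭ ε' q
  in  _ , trans p' q' , ε''

mutual
  -- Coherence fixes where the occurrences of the variable are, so the bag can be read off the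
  -- result. Coherent terms with opposite injections keep them under substitution and cannot give
  -- equal results.
  ∂T-injective : s ≍t s' → ∂T d s us f → ∂T d s' us' f' → f ≈t f' → s ≈t s' × us ≈m us'
  ∂T-injective {d = d} (var n) (here _) (here _) p = var n , shiftT-injective 0 d p ∷ []
  ∂T-injective (var n) (here refl)    (below q)      _ = ⊥-elim (<-irrefl refl q)
  ∂T-injective (var n) (here refl)    (above refl q) _ = ⊥-elim (<-irrefl refl q)
  ∂T-injective (var n) (below q)      (here refl)    _ = ⊥-elim (<-irrefl refl q)
  ∂T-injective (var n) (below _)      (below _)      _ = var n , []
  ∂T-injective (var n) (below _)      (above _ _)    _ = var n , []
  ∂T-injective (var n) (above refl q) (here refl)    _ = ⊥-elim (<-irrefl refl q)
  ∂T-injective (var n) (above _ _)    (below _)      _ = var n , []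
  ∂T-injective (var n) (above _ _)    (above _ _)    _ = var n , []
  ∂T-injective (lam c) (lam δ) (lam δ') (lam p) =
    let q , r = ∂T-injective c δ δ' p in lam q , r
  ∂T-injective (app c c') (app i δ ε) (app i' δ' ε') (app p p') =
    let q  , r  = ∂T-injective c δ δ' p
        q' , r' = ∂M-injective c' ε ε' p'
    in  app q q' , interleaving-≈m i i' r r'
  ∂T-injective (inl• c) (inl• δ) (inl• δ') (inl• p) =
    let q , r = ∂T-injective c δ δ' p in inl• q , r
  ∂T-injective (inr• c) (inr• δ) (inr• δ') (inr• p) =
    let q , r = ∂T-injective c δ δ' p in inr• q , r
  ∂T-injective (inlr _ _) (inl• _) (inr• _) ()
  ∂T-injective (inrl _ _) (inr• _) (inl• _) ()

  ∂M-injective : ts ≍m ts' → ∂M d ts us ms → ∂M d ts' us' ms' → ms ≈m ms' →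
    ts ≈m ts' × us ≈m us'
  ∂M-injective {ts = ts} c ε ε' p =
    let _ , π , eqs = ≈m⇒↭∘≈t p
        _ , ρ , ε°  = ∂M-resp-↭ ε π
        q , r = ∂M-pointwise-injective c
                  (λ t∈ → ∈-++⁺ˡ (∈-resp-↭ (↭-sym ρ) t∈)) (∈-++⁺ʳ ts) ε° ε' eqs
    in  trans (↭⇒≈m ρ) q , r

  -- The aligning permutation may pair any element with any other. Keeping the whole clique
  -- `ts ++ ts'` fixed makes every pair coherent while the lists shrink.
  ∂M-pointwise-injective : {vs vs' : Monomial} → ts ≍m ts' →
    (∀ {t} → t ∈ vs → t ∈ (ts ++ ts')) → (∀ {t} → t ∈ vs' → t ∈ (ts ++ ts')) →
    ∂M d vs us ms → ∂M d vs' us' ms' → Pointwise _≈t_ ms ms' → vs ≈m vs' × us ≈m us'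
  ∂M-pointwise-injective c ⊆ ⊆' [] [] [] = [] , []
  ∂M-pointwise-injective {ts = ts} {ts' = ts'} (coh h) ⊆ ⊆' (cons i δ ε) (cons i' δ' ε') (p ∷ ps) =
    let q  , r  = ∂T-injective (h _ _ (⊆ (here refl)) (⊆' (here refl))) δ δ' p
        q' , r' = ∂M-pointwise-injective {ts = ts} {ts' = ts'} (coh h)
                    (λ t∈ → ⊆ (there t∈)) (λ t∈ → ⊆' (there t∈)) ε ε' ps
    in  q ∷ q' , interleaving-≈m i i' r r'

-- The head machine

Stack : Set
Stack = List Monomial

private
  variable
    π π' ρ ρ' : Stack

unwind : Term → Stack → Term
unwind s []       = s
unwind s (ts ∷ π) = unwind (app s ts) π

-- The variants of lam n obtained by moving sums out of the abstraction. The
-- first rule also applies to sums, so the last argument need not be normal.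
data Lam : Term → Term → Set where
  lam  : Lam s (lam s)
  inl• : Lam s s' → Lam (inl• s) (inl• s')
  inr• : Lam s s' → Lam (inr• s) (inr• s')

infix 4 _∣_⇓_ _⇓m_ _⇓π_

mutual
  -- The rules `inl•` and `inr•` keep the stack, which builds in the commutation of sums with
  -- application. The top of the stack is the argument nearest to the head.
  data _∣_⇓_ : Term → Stack → Term → Set where
    var  : π ⇓π ρ → var n ∣ π ⇓ unwind (var n) ρ
    app  : s ∣ ts ∷ π ⇓ t → app s ts ∣ π ⇓ t
    β    : ∂T 0 s ts f → f ∣ π ⇓ t → lam s ∣ ts ∷ π ⇓ t
    lam  : s ∣ [] ⇓ t → Lam t t' → lam s ∣ [] ⇓ t'
    inl• : s ∣ π ⇓ t → inl• s ∣ π ⇓ inl• t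
    inr• : s ∣ π ⇓ t → inr• s ∣ π ⇓ inr• t

  _⇓m_ : Monomial → Monomial → Set
  _⇓m_ = Pointwise (_∣ [] ⇓_)

  _⇓π_ : Stack → Stack → Set
  _⇓π_ = Pointwise _⇓m_

-- Closure of the machine under expansion

mutual
  -- Induction on the evaluation rather than on the step: passing a substitution replaces the step
  -- by another single step, while the evaluation gets smaller.
  ⇓-expand : s ↝ s' → s' ∣ π ⇓ t → s ∣ π ⇓ t
  ⇓-expand (β δ) e = app (β δ e)
  ⇓-expand appL (inl• (app e)) = app (inl• e)
  ⇓-expand appR (inr• (app e)) = app (inr• e)
  ⇓-expand lamL (inl• (lam e l)) = lam (inl• e) (inl• l)
  -- On a nonempty stack the abstraction is contracted at once, and the sum comes out after the
  -- substitution instead of before it.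
  ⇓-expand lamL (inl• (β δ e)) = β (inl• δ) (inl• e)
  ⇓-expand lamR (inr• (lam e l)) = lam (inr• e) (inr• l)
  ⇓-expand lamR (inr• (β δ e)) = β (inr• δ) (inr• e)
  ⇓-expand (ξlam r) (lam e l) = lam (⇓-expand r e) l
  ⇓-expand (ξlam r) (β δ e) = let _ , δ' , r' = ∂T-expandˡ r δ in β δ' (⇓-expand r' e)
  ⇓-expand (ξfun r) (app e) = app (⇓-expand r e)
  ⇓-expand (ξarg r) (app e) = app (⇓-expandπ (here r) e)
  ⇓-expand (ξinl• r) (inl• e) = inl• (⇓-expand r e)
  ⇓-expand (ξinr• r) (inr• e) = inr• (⇓-expand r e)

  ⇓-expandπ : AtOne _↝m_ π π' → s ∣ π' ⇓ t → s ∣ π ⇓ t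
  ⇓-expandπ r         (var es)  = var (⇓π-expand r es)
  ⇓-expandπ r         (app e)   = app (⇓-expandπ (there r) e)
  ⇓-expandπ (here r)  (β δ e)   = let _ , δ' , r' = ∂T-expandʳ r δ in β δ' (⇓-expand r' e)
  ⇓-expandπ (there r) (β δ e)   = β δ (⇓-expandπ r e)
  ⇓-expandπ r         (inl• e)  = inl• (⇓-expandπ r e)
  ⇓-expandπ r         (inr• e)  = inr• (⇓-expandπ r e)

  ⇓m-expand : ts ↝m ts' → ts' ⇓m ms → ts ⇓m ms
  ⇓m-expand (here r)  (e ∷ es) = ⇓-expand r e ∷ es
  ⇓m-expand (there r) (e ∷ es) = e ∷ ⇓m-expand r es

  ⇓π-expand : AtOne _↝m_ π π' → π' ⇓π ρ → π ⇓π ρ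
  ⇓π-expand (here r)  (e ∷ es) = ⇓m-expand r e ∷ es
  ⇓π-expand (there r) (e ∷ es) = e ∷ ⇓π-expand r es

-- Irreducible expressions evaluate to themselves

mutual
  irreducible-⇓ : ∀ t → (∀ E → ¬ t ⟶t E) → t ∣ [] ⇓ t
  irreducible-⇓ (var n)    irr = var []
  irreducible-⇓ (lam s)    irr = lam (irreducible-⇓ s λ _ r → irr _ (ξlam r)) lam
  irreducible-⇓ (app s ts) irr = irreducible-unwind s ts irr []
  irreducible-⇓ (inl• s)   irr = inl• (irreducible-⇓ s λ _ r → irr _ (ξinl• r))
  irreducible-⇓ (inr• s)   irr = inr• (irreducible-⇓ s λ _ r → irr _ (ξinr• r))

  -- Descends the spine while collecting evaluated arguments. The head must be a variable, as any
  -- other head would form a redex with its argument.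
  irreducible-unwind : ∀ s ts → (∀ E → ¬ app s ts ⟶t E) → π ⇓π ρ →
    app s ts ∣ π ⇓ unwind (app s ts) ρ
  irreducible-unwind (var n) ts irr es =
    app (var (irreducible-⇓m ts (λ _ r → irr _ (ξarg _ r)) ∷ es))
  irreducible-unwind (app s us) ts irr es =
    app (irreducible-unwind s us (λ _ r → irr _ (ξfun ts r))
          (irreducible-⇓m ts (λ _ r → irr _ (ξarg _ r)) ∷ es))
  irreducible-unwind (lam s)  ts irr es = ⊥-elim (irr _ (β s ts))
  irreducible-unwind (inl• s) ts irr es = ⊥-elim (irr _ (appL s ts))
  irreducible-unwind (inr• s) ts irr es = ⊥-elim (irr _ (appR s ts))

  irreducible-⇓m : ∀ ts → (∀ E → ¬ ts ⟶m E) → ts ⇓m ts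
  irreducible-⇓m []       irr = []
  irreducible-⇓m (t ∷ ts) irr =
    irreducible-⇓ t (λ _ r → irr _ (here ts r)) ∷
    irreducible-⇓m ts (λ _ r → irr _ (there t r))

-- Results determine coherent inputs

Lam-injective : Lam s t → Lam s' t' → t ≈t t' → s ≈t s'
-- The sums in front of the first abstraction record how many were moved out, so equal results come
-- from the same rules.
Lam-injective lam      lam       (lam p)  = p
Lam-injective (inl• l) (inl• l') (inl• p) = inl• (Lam-injective l l' p)
Lam-injective (inr• l) (inr• l') (inr• p) = inr• (Lam-injective l l' p)

-- Packages injectivity at one evaluation, with the other side universally quantified. Such facts
-- are produced from structurally smaller evaluations first and permuted only afterwards, so the
-- recursion stays structural.
Determinedt : Term → Term → Set
Determinedt t m = ∀ {t' m'} → t ≍t t' → t' ∣ [] ⇓ m' → m ≈t m' → t ≈t t'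

Determinedm : Monomial → Monomial → Set
Determinedm ts ms = ∀ {ts' ms'} → ts ≍m ts' → ts' ⇓m ms' → ms ≈m ms' → ts ≈m ts'

Determinedt⇒Determinedm : Pointwise Determinedt ts ms → Determinedm ts ms
Determinedt⇒Determinedm {ts = ts} ds {ts'} (coh h) es p =
  let _ , ρ  , eqs = ≈m⇒↭∘≈t p
      _ , ρ' , ds' = Pointwise-resp-↭ ds ρ
  in  trans (↭⇒≈m ρ')
        (pointwise (λ t∈ → ∈-++⁺ˡ (∈-resp-↭ (↭-sym ρ') t∈)) (∈-++⁺ʳ ts) ds' es eqs)
  where
  pointwise : ∀ {vs ms vs' ms'} →
    (∀ {t} → t ∈ vs → t ∈ (ts ++ ts')) → (∀ {t} → t ∈ vs' → t ∈ (ts ++ ts')) →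
    Pointwise Determinedt vs ms → vs' ⇓m ms' → Pointwise _≈t_ ms ms' → vs ≈m vs'
  pointwise ⊆ ⊆' []       []       []       = []
  pointwise ⊆ ⊆' (d ∷ ds) (e ∷ es) (p ∷ ps) =
    d (h _ _ (⊆ (here refl)) (⊆' (here refl))) e p ∷
    pointwise (λ t∈ → ⊆ (there t∈)) (λ t∈ → ⊆' (there t∈)) ds es ps

-- Coherent stacks have equal length, so both spines are peeled in step down to their heads.
unwind-injective : Pointwise Determinedm π ρ → Pointwise _≍m_ π π' → π' ⇓π ρ' →
  unwind s ρ ≈t unwind s' ρ' → s ≈t s' × Pointwise _≈m_ π π'
unwind-injective []       []       []       p = p , []
unwind-injective (d ∷ ds) (c ∷ cs) (e ∷ es) p with unwind-injective ds cs es p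
... | app q r , qs = q , d c e r ∷ qs

mutual
  -- Induction on the first evaluation: coherence of heads and equal stack lengths force the second
  -- to use the same rule, unless opposite injections already make the results differ.
  ⇓-injective : s ∣ π ⇓ t → s ≍t s' → Pointwise _≍m_ π π' → s' ∣ π' ⇓ t' → t ≈t t' →
    s ≈t s' × Pointwise _≈m_ π π'
  ⇓-injective (var es) (var n) cs (var es') p =
    unwind-injective (⇓π-determined es) cs es' p
  ⇓-injective (app e) (app c c') cs (app e') p
    with q , r ∷ rs ← ⇓-injective e c (c' ∷ cs) e' p = app q r , rs
  ⇓-injective (β δ e) (lam c) (coh h ∷ cs) (β δ' e') p =
    -- The clique is membership in the concatenation of both bags. Equality is pulled back first to
    -- the contracta and then through the substitution.
    let all  = All.tabulate ∈-++⁺ˡ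
        all' = All.tabulate (∈-++⁺ʳ _)
        q , qs = ⇓-injective e (∂T-≍ (h _ _) c all all' δ δ') cs e' p
        r , r' = ∂T-injective c δ δ' q
    in  lam r , r' ∷ qs
  ⇓-injective (lam e l) (lam c) [] (lam e' l') p =
    lam (proj₁ (⇓-injective e c [] e' (Lam-injective l l' p))) , []
  ⇓-injective (inl• e) (inl• c) cs (inl• e') (inl• p) =
    let q , qs = ⇓-injective e c cs e' p in inl• q , qs
  ⇓-injective (inr• e) (inr• c) cs (inr• e') (inr• p) =
    let q , qs = ⇓-injective e c cs e' p in inr• q , qs
  ⇓-injective (inl• e) (inlr _ _) cs (inr• e') ()
  ⇓-injective (inr• e) (inrl _ _) cs (inl• e') ()

  ⇓m-determined : ts ⇓m ms → Pointwise Determinedt ts ms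
  ⇓m-determined []       = []
  ⇓m-determined (e ∷ es) =
    (λ c e' p → proj₁ (⇓-injective e c [] e' p)) ∷ ⇓m-determined es

  ⇓π-determined : π ⇓π ρ → Pointwise Determinedm π ρ
  ⇓π-determined []       = []
  ⇓π-determined (e ∷ es) = Determinedt⇒Determinedm (⇓m-determined e) ∷ ⇓π-determined es

-- Formal sums

module _ (σ : Sort) (P : Exp σ → Set)
         (expand : ∀ {e E f} → e ⟶ E → f ∈ E → P f → P e) where

  -- An element of the reduct was either untouched or produced by the contracted summand, to which
  -- `expand` applies.
  ⇒-expand : {E F : Sum σ} → E ⇒ F → Any P F → Any P E
  ⇒-expand (here {E' = E'} F r) a with Any.++⁻ E' a
  ... | inj₁ a' = let _ , f∈ , p = find a' in here (expand r f∈ p)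
  ... | inj₂ a' = there a'
  ⇒-expand (there f r) (here p)  = here p
  ⇒-expand (there f r) (there a) = there (⇒-expand r a)

  ⇒*-expand : {E F : Sum σ} → E ⇒* F → Any P F → Any P E
  ⇒*-expand Star.ε   a = a
  ⇒*-expand (r ◅ rs) a = ⇒-expand r (⇒*-expand rs a)

Normal⇒irreducible : ∀ σ {N : Sum σ} {e} → Normal N → e ∈ N → ∀ E → ¬ (e ⟶ E)
Normal⇒irreducible σ nf (here refl) E r = nf _ (here _ r)
Normal⇒irreducible σ nf (there e∈)  E r =
  Normal⇒irreducible σ (λ _ r' → nf _ (there _ r')) e∈ E r

IsNF⇒⇓ : ∀ {N} → IsNF {tm} [ s ] N → f ∈ N → s ∣ [] ⇓ f
IsNF⇒⇓ {f = f} (rs , nf) f∈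
  -- The predicate is evaluation to the fixed `f`. It holds at `f` by irreducibility and is carried
  -- back to the only element of the initial sum.
  with here e ← ⇒*-expand tm (_∣ [] ⇓ f) (λ r g∈ → ⇓-expand (⟶t-sound r g∈)) rs
                 (Any.map (λ { refl → irreducible-⇓ f (Normal⇒irreducible tm nf f∈) }) f∈) = e

IsNF⇒⇓m : ∀ {N} → IsNF {mn} [ ts ] N → ms ∈ N → ts ⇓m ms
IsNF⇒⇓m {ms = ms} (rs , nf) f∈
  with here e ← ⇒*-expand mn (_⇓m ms) (λ r g∈ → ⇓m-expand (⟶m-sound r g∈)) rs
                 (Any.map (λ { refl → irreducible-⇓m ms (Normal⇒irreducible mn nf f∈) }) f∈) = e

theorem6p8 : ∀ (σ : Sort) (e e' : Exp σ) → e ≍ e' →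
    ∀ (N N' : Sum σ) → IsNF [ e ] N → IsNF [ e' ] N' →
    SuppMeet N N' → e ≈ e'
theorem6p8 tm e e' c N N' nf nf' (a , (b , b∈ , p) , (b' , b'∈ , p')) =
  proj₁ (⇓-injective (IsNF⇒⇓ nf b∈) c [] (IsNF⇒⇓ nf' b'∈) (≈t-trans (≈t-sym p) p'))
theorem6p8 mn e e' c N N' nf nf' (a , (b , b∈ , p) , (b' , b'∈ , p')) =
  Determinedt⇒Determinedm (⇓m-determined (IsNF⇒⇓m nf b∈)) c (IsNF⇒⇓m nf' b'∈)
    (trans (≈m-sym p) p')
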